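{- Let $m\ge 4$. There is no algorithm (even randomized) achieving a constant competitive ratio for the parametrized metrical service system problem with $m$ request types on hierarchically separated trees; that is, for every constant $C$ there exist a hierarchically separated tree and $m$ request types $K_1,\dots,K_m$ on it such that no randomized online algorithm has competitive ratio at most $C$ on the corresponding problem.
   Context: Parametrized metrical service system (MSS): given are a finite metric space $(X,d)$ and a fixed collection of $m$ non-empty subsets $K_1,\dots,K_m$ of $X$ (the request types), known to the algorithm in advance. An instance consists of an initial state $s_0\in X$ and a finite sequence of requests $\boldsymbol\rho=(\rho_1,\rho_2,\dots)$, each $\rho_t\in\{K_1,\dots,K_m\}$, revealed one at a time. On arrival of $\rho_t$, the algorithm must choose a state $s_t\in\rho_t$ without knowledge of future requests. The cost of a solution is $\sum_{t\ge1}d(s_{t-1},s_t)$. Let $\mathrm{cost}^*(\boldsymbol\rho)$ be the minimum cost of a feasible (offline) solution. A randomized online algorithm $\mathcal A$ has competitive ratio $c$ if there is a constant $\beta$, independent of the input sequence (but possibly depending on the metric space), such that $\mathbb E[\mathrm{cost}_{\mathcal A}(\boldsymbol\rho)]\le c\cdot \mathrm{cost}^*(\boldsymbol\rho)+\beta$ for every (fixed) input. Hierarchically separated tree (HST): a finite rooted edge-weighted tree in which all root-to-leaf paths have the same number of edges; the level of a node is the number of edges from it to any descendant leaf (leaves have level $0$); the edges between an internal node and all of its children have the same weight, which depends only on the level of the node. The points of the metric space are the leaves, with the tree path distance. The number of levels of the tree is arbitrary. -}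

module Defs where

open import Level using (Level; _⊔_) renaming (suc to lsuc)
open import Algebra.Apartness.Bundles using (HeytingField; HeytingCommutativeRing)
open import Algebra.Bundles using (CommutativeRing)
open import Data.Fin using (Fin; zero; suc)
open import Data.Fin.Properties using (_≟_; +↔⊎; 1↔⊤)
open import Data.Fin.Subset using (Subset; _∈_; _∉_)
open import Data.List using (List; []; _∷_)
open import Data.List.Relation.Unary.All using (All; []; _∷_)
open import Data.Nat as ℕ using (ℕ; zero; suc)
open import Data.Product using (Σ; ∃; ∃-syntax; _×_; _,_; proj₁; proj₂)
open import Data.Sum using (_⊎_; inj₁; inj₂)
open import Data.Sum.Function.Propositional using (_⊎-↔_)
open import Data.Unit using (tt)
open import Function using (_∘_; _↔_; mk↔ₛ′; Inverse; Injection)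
open import Function.Metric.Structures using (IsGeneralMetric)
open import Function.Properties.Inverse using (↔-trans; Inverse⇒Injection)
open import Relation.Binary.Core using (Rel)
open import Relation.Binary.Structures using (IsStrictPartialOrder; IsPartialOrder)
open import Relation.Binary.PropositionalEquality as ≡ using (_≡_)
open import Relation.Nullary using (¬_; yes; no; contradiction)
import Algebra.Definitions.RawMonoid as RawMonoidDefinitions
import Data.Vec.Functional as Vector

-- The standard library has no type of real numbers, so they are
-- described axiomatically: an Archimedean ordered field in which every
-- Cauchy sequence converges.  Classically these axioms determine ℝ up to
-- a unique isomorphism.  The form chosen (a primitive strict order
-- inducing the apartness, no decidability) is also satisfied by the
-- constructive Cauchy and Dedekind reals.

record RealNumbers (c ℓ₁ ℓ₂ : Level) : Set (lsuc (c ⊔ ℓ₁ ⊔ ℓ₂)) where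
  infix 4 _<_ _≤_
  field
    heytingField : HeytingField c ℓ₁ ℓ₂

  open HeytingField heytingField public

  open HeytingCommutativeRing heytingCommutativeRing public using (commutativeRing)
  open RawMonoidDefinitions (CommutativeRing.+-rawMonoid commutativeRing) public
    using (sum) renaming (_×_ to _·_)

  field
    _<_                    : Rel Carrier ℓ₂
    <-isStrictPartialOrder : IsStrictPartialOrder _≈_ _<_
    #⇒<⊎>                  : ∀ {x y} → x # y → x < y ⊎ y < x
    <⇒#                    : ∀ {x y} → x < y → x # y
    +-monoˡ-<              : ∀ z {x y} → x < y → x + z < y + z
    *-positive             : ∀ {x y} → 0# < x → 0# < y → 0# < x * y
    archimedean            : ∀ x → ∃[ n ] x < n · 1#

  _≤_ : Rel Carrier ℓ₂
  x ≤ y = ¬ (y < x)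

  -- ∣ x - y ∣ < ε
  Within : Carrier → Carrier → Carrier → Set ℓ₂
  Within ε x y = x - y < ε × y - x < ε

  IsCauchy : (ℕ → Carrier) → Set (c ⊔ ℓ₂)
  IsCauchy f = ∀ ε → 0# < ε →
    ∃[ N ] ∀ i j → N ℕ.≤ i → N ℕ.≤ j → Within ε (f i) (f j)

  _ConvergesTo_ : (ℕ → Carrier) → Carrier → Set (c ⊔ ℓ₂)
  f ConvergesTo x = ∀ ε → 0# < ε → ∃[ N ] ∀ i → N ℕ.≤ i → Within ε (f i) x

  field
    complete : ∀ f → IsCauchy f → ∃[ x ] f ConvergesTo x

  open IsStrictPartialOrder <-isStrictPartialOrder public
    using (<-respˡ-≈; <-respʳ-≈)
    renaming (irrefl to <-irrefl; trans to <-trans; asym to <-asym)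

  <-cotrans : ∀ {x y} → x < y → ∀ z → x < z ⊎ z < y
  <-cotrans x<y z with #-cotrans (<⇒# x<y) z
  ... | inj₁ x#z with #⇒<⊎> x#z
  ...   | inj₁ x<z = inj₁ x<z
  ...   | inj₂ z<x = inj₂ (<-trans z<x x<y)
  <-cotrans x<y z | inj₂ z#y with #⇒<⊎> z#y
  ...   | inj₁ z<y = inj₂ z<y
  ...   | inj₂ y<z = inj₁ (<-trans x<y y<z)

  ≤-reflexive : ∀ {x y} → x ≈ y → x ≤ y
  ≤-reflexive x≈y = <-irrefl (sym x≈y)

  ≤-trans : ∀ {x y z} → x ≤ y → y ≤ z → x ≤ z
  ≤-trans {y = y} x≤y y≤z z<x with <-cotrans z<x y
  ... | inj₁ z<y = y≤z z<y
  ... | inj₂ y<x = x≤y y<x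

  ≤-antisym : ∀ {x y} → x ≤ y → y ≤ x → x ≈ y
  ≤-antisym {x} {y} x≤y y≤x = proj₁ (tight x y) λ x#y → apart (#⇒<⊎> x#y)
    where
    apart : ¬ (x < y ⊎ y < x)
    apart (inj₁ x<y) = y≤x x<y
    apart (inj₂ y<x) = x≤y y<x

  <⇒≤ : ∀ {x y} → x < y → x ≤ y
  <⇒≤ = <-asym

  ≤-isPartialOrder : IsPartialOrder _≈_ _≤_
  ≤-isPartialOrder = record
    { isPreorder = record
      { isEquivalence = isEquivalence
      ; reflexive     = ≤-reflexive
      ; trans         = ≤-trans
      }
    ; antisym = ≤-antisym
    }

  +-monoˡ-≤ : ∀ z {x y} → x ≤ y → x + z ≤ y + z
  +-monoˡ-≤ z x≤y y+z<x+z =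
    x≤y (<-respˡ-≈ (cancel _) (<-respʳ-≈ (cancel _) (+-monoˡ-< (- z) y+z<x+z)))
    where
    cancel : ∀ u → (u + z) + - z ≈ u
    cancel u = trans (+-assoc u z (- z)) (trans (+-congˡ (-‿inverseʳ z)) (+-identityʳ u))

  +-mono-≤ : ∀ {x y u v} → x ≤ y → u ≤ v → x + u ≤ y + v
  +-mono-≤ {x} {y} {u} {v} x≤y u≤v = ≤-trans (+-monoˡ-≤ u x≤y)
    (≤-trans (≤-reflexive (+-comm y u)) (≤-trans (+-monoˡ-≤ y u≤v) (≤-reflexive (+-comm v y))))

  x≤x+y : ∀ {x y} → 0# ≤ y → x ≤ x + y
  x≤x+y {x} 0≤y = ≤-trans (≤-reflexive (sym (+-identityʳ x))) (+-mono-≤ (≤-reflexive refl) 0≤y)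

  x≤y+x : ∀ {x y} → 0# ≤ y → x ≤ y + x
  x≤y+x {x} {y} 0≤y = ≤-trans (x≤x+y 0≤y) (≤-reflexive (+-comm x y))

  +-nonneg : ∀ {x y} → 0# ≤ x → 0# ≤ y → 0# ≤ x + y
  +-nonneg 0≤x 0≤y = ≤-trans 0≤x (x≤x+y 0≤y)

  +-positiveˡ : ∀ {x y} → 0# < x → 0# ≤ y → 0# < x + y
  +-positiveˡ {x} {y} 0<x 0≤y with <-cotrans 0<x (x + y)
  ... | inj₁ 0<x+y = 0<x+y
  ... | inj₂ x+y<x = contradiction x+y<x (x≤x+y 0≤y)

module _ {c ℓ₁ ℓ₂} (ℝ : RealNumbers c ℓ₁ ℓ₂) where
  open RealNumbers ℝ hiding (zero)

  record FiniteMetricSpace : Set (c ⊔ ℓ₁ ⊔ ℓ₂) where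
    field
      size     : ℕ
      d        : Fin size → Fin size → Carrier
      isMetric : IsGeneralMetric _≡_ _≈_ _≤_ 0# _+_ d

    Point : Set
    Point = Fin size

  module MSS (X : FiniteMetricSpace) {m : ℕ} (K : Fin m → Subset (FiniteMetricSpace.size X)) where
    open FiniteMetricSpace X using (size; d; Point)

    Request : Set
    Request = Fin m

    Solution : List Request → Set
    Solution = All (λ r → ∃[ x ] x ∈ K r)

    cost : Point → ∀ {ρ} → Solution ρ → Carrier
    cost s []             = 0#
    cost s ((x , _) ∷ xs) = d s x + cost x xs

    -- v = cost*(ρ) for the initial state s₀.
    IsOptimalCost : Point → List Request → Carrier → Set (ℓ₁ ⊔ ℓ₂)
    IsOptimalCost s₀ ρ v =
      (∃[ xs ] cost s₀ {ρ} xs ≈ v) × (∀ (xs : Solution ρ) → v ≤ cost s₀ xs)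

    record Distribution (S : Subset size) : Set (c ⊔ ℓ₁ ⊔ ℓ₂) where
      field
        mass      : Point → Carrier
        mass≥0    : ∀ x → 0# ≤ mass x
        supported : ∀ x → x ∉ S → mass x ≈ 0#
        total     : sum mass ≈ 1#

      expectation : (Point → Carrier) → Carrier
      expectation f = sum (λ x → mass x * f x)

    -- The requests served so far with the states chosen for them, most
    -- recent first.
    History : Set
    History = List (Request × Point)

    -- The conditional distribution of the next state, given everything
    -- observed so far (the initial state, the past requests and the
    -- algorithm's own past random choices) and the current request.
    -- Since an algorithm remembers its past choices, every randomization
    -- over deterministic online algorithms has this form.
    RandomizedAlgorithm : Set (c ⊔ ℓ₁ ⊔ ℓ₂)
    RandomizedAlgorithm = (s₀ : Point) → History → (r : Request) → Distribution (K r)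

    module _ (A : RandomizedAlgorithm) where

      -- h is the history, s the current state.
      expectedCostFrom : (s₀ : Point) → History → (s : Point) → List Request → Carrier
      expectedCostFrom s₀ h s []      = 0#
      expectedCostFrom s₀ h s (r ∷ ρ) = Distribution.expectation (A s₀ h r)
        (λ x → d s x + expectedCostFrom s₀ ((r , x) ∷ h) x ρ)

      expectedCost : Point → List Request → Carrier
      expectedCost s₀ ρ = expectedCostFrom s₀ [] s₀ ρ

      HasCompetitiveRatio : Carrier → Set (c ⊔ ℓ₁ ⊔ ℓ₂)
      HasCompetitiveRatio γ = ∃[ β ] ∀ s₀ ρ v →
        IsOptimalCost s₀ ρ v → expectedCost s₀ ρ ≤ γ * v + β

-- Tree l: finite rooted trees whose root has level l, i.e. all
-- root-to-leaf paths have l edges.  An internal node has suc k ≥ 1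
-- children.
data Tree : ℕ → Set where
  leaf : Tree 0
  node : ∀ {l} k (children : Fin (suc k) → Tree l) → Tree (suc l)

data Leaf : ∀ {l} → Tree l → Set where
  root  : Leaf leaf
  below : ∀ {l k} {children : Fin (suc k) → Tree l} i → Leaf (children i) → Leaf (node k children)

numLeaves : ∀ {l} → Tree l → ℕ
numLeaves leaf              = 1
numLeaves (node k children) = Vector.foldr ℕ._+_ 0 (λ i → numLeaves (children i))

private
  sum↔Σ : ∀ {k} (n : Fin k → ℕ) {A : Fin k → Set} → (∀ i → Fin (n i) ↔ A i) →
          Fin (Vector.foldr ℕ._+_ 0 n) ↔ Σ (Fin k) A
  sum↔Σ {zero}  n e = mk↔ₛ′ (λ ()) (λ ()) (λ ()) (λ ())
  sum↔Σ {suc k} n {A} e =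
    ↔-trans +↔⊎ (↔-trans (e zero ⊎-↔ sum↔Σ (n ∘ suc) (λ i → e (suc i))) split)
    where
    split : (A zero ⊎ Σ (Fin k) (A ∘ suc)) ↔ Σ (Fin (suc k)) A
    split = mk↔ₛ′
      (λ { (inj₁ a) → zero , a ; (inj₂ (i , a)) → suc i , a })
      (λ { (zero , a) → inj₁ a ; (suc i , a) → inj₂ (i , a) })
      (λ { (zero , a) → ≡.refl ; (suc i , a) → ≡.refl })
      (λ { (inj₁ a) → ≡.refl ; (inj₂ (i , a)) → ≡.refl })

enumerateLeaves : ∀ {l} (t : Tree l) → Fin (numLeaves t) ↔ Leaf t
enumerateLeaves leaf = ↔-trans 1↔⊤ (mk↔ₛ′ (λ _ → root) (λ _ → tt) (λ { root → ≡.refl }) (λ _ → ≡.refl))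
enumerateLeaves (node k children) =
  ↔-trans (sum↔Σ (λ i → numLeaves (children i)) (λ i → enumerateLeaves (children i)))
    (mk↔ₛ′ (λ (i , x) → below i x) unbelow (λ { (below i x) → ≡.refl }) (λ _ → ≡.refl))
  where
  unbelow : Leaf (node k children) → Σ (Fin (suc k)) (λ i → Leaf (children i))
  unbelow (below i x) = i , x

module _ {c ℓ₁ ℓ₂} (ℝ : RealNumbers c ℓ₁ ℓ₂) where
  open RealNumbers ℝ hiding (zero)

  record HST : Set (c ⊔ ℓ₂) where
    field
      {height}  : ℕ
      tree      : Tree height
      -- Weight of the edges between an internal node of the given level
      -- and its children; the values at 0 and above height are unused.
      weight    : ℕ → Carrier
      weight>0  : ∀ l → 0# < weight l

  module _ (weight : ℕ → Carrier) where

    -- Length of the path from a node of level l to any leaf below it.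
    depth : ℕ → Carrier
    depth zero    = 0#
    depth (suc l) = weight (suc l) + depth l

    -- Length of the tree path: leaves below different children of a node
    -- are joined by the path through that node.
    pathDistance : ∀ {l} {t : Tree l} → Leaf t → Leaf t → Carrier
    pathDistance root root = 0#
    pathDistance {suc l} (below i x) (below j y) with i ≟ j
    ... | yes ≡.refl = pathDistance x y
    ... | no _       = depth (suc l) + depth (suc l)

  module _ {weight : ℕ → Carrier} (weight>0 : ∀ l → 0# < weight l) where
    private
      D : ∀ {l} {t : Tree l} → Leaf t → Leaf t → Carrier
      D = pathDistance weight

    depth≥0 : ∀ l → 0# ≤ depth weight l
    depth≥0 zero    = ≤-reflexive refl
    depth≥0 (suc l) = +-nonneg (<⇒≤ (weight>0 (suc l))) (depth≥0 l)

    pathDistance-nonneg : ∀ {l} {t : Tree l} (x y : Leaf t) → 0# ≤ D x y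
    pathDistance-nonneg root root = ≤-reflexive refl
    pathDistance-nonneg {suc l} (below i x) (below j y) with i ≟ j
    ... | yes ≡.refl = pathDistance-nonneg x y
    ... | no _       = +-nonneg (depth≥0 (suc l)) (depth≥0 (suc l))

    pathDistance-refl : ∀ {l} {t : Tree l} (x : Leaf t) → D x x ≈ 0#
    pathDistance-refl root = refl
    pathDistance-refl (below i x) with i ≟ i
    ... | yes ≡.refl = pathDistance-refl x
    ... | no i≢i     = contradiction ≡.refl i≢i

    pathDistance≈0⇒≡ : ∀ {l} {t : Tree l} (x y : Leaf t) → D x y ≈ 0# → x ≡ y
    pathDistance≈0⇒≡ root root _ = ≡.refl
    pathDistance≈0⇒≡ {suc l} (below i x) (below j y) eq with i ≟ j
    ... | yes ≡.refl = ≡.cong (below i) (pathDistance≈0⇒≡ x y eq)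
    ... | no _       = contradiction
      (+-positiveˡ (+-positiveˡ (weight>0 (suc l)) (depth≥0 l)) (depth≥0 (suc l)))
      (<-irrefl (sym eq))

    pathDistance-sym : ∀ {l} {t : Tree l} (x y : Leaf t) → D x y ≈ D y x
    pathDistance-sym root root = refl
    pathDistance-sym (below i x) (below j y) with i ≟ j | j ≟ i
    ... | yes ≡.refl | yes ≡.refl = pathDistance-sym x y
    ... | yes ≡.refl | no j≢i     = contradiction ≡.refl j≢i
    ... | no i≢j     | yes ≡.refl = contradiction ≡.refl i≢j
    ... | no _       | no _       = refl

    pathDistance≤2depth : ∀ {l} {t : Tree l} (x y : Leaf t) →
                          D x y ≤ depth weight l + depth weight l
    pathDistance≤2depth root root = ≤-reflexive (sym (+-identityˡ 0#))
    pathDistance≤2depth {suc l} (below i x) (below j y) with i ≟ j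
    ... | yes ≡.refl = ≤-trans (pathDistance≤2depth x y) (+-mono-≤ step step)
      where
      step : depth weight l ≤ depth weight (suc l)
      step = x≤y+x (<⇒≤ (weight>0 (suc l)))
    ... | no _       = ≤-reflexive refl

    pathDistance-triangle : ∀ {l} {t : Tree l} (x y z : Leaf t) → D x z ≤ D x y + D y z
    pathDistance-triangle root root root = ≤-reflexive (sym (+-identityˡ 0#))
    pathDistance-triangle (below i x) (below j y) (below k z) with i ≟ j | j ≟ k
    pathDistance-triangle (below i x) (below j y) (below k z) | yes ≡.refl | yes ≡.refl with i ≟ i
    ... | yes ≡.refl = pathDistance-triangle x y z
    ... | no i≢i     = contradiction ≡.refl i≢i
    pathDistance-triangle {suc l} (below i x) (below j y) (below k z) | yes ≡.refl | no i≢k =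
      ≤-trans (pathDistance≤2depth (below i x) (below k z)) (x≤y+x (pathDistance-nonneg x y))
    pathDistance-triangle {suc l} (below i x) (below j y) (below k z) | no _ | yes ≡.refl =
      ≤-trans (pathDistance≤2depth (below i x) (below k z)) (x≤x+y (pathDistance-nonneg y z))
    pathDistance-triangle {suc l} (below i x) (below j y) (below k z) | no _ | no _ =
      ≤-trans (pathDistance≤2depth (below i x) (below k z))
        (x≤x+y (+-nonneg (depth≥0 (suc l)) (depth≥0 (suc l))))

  leafSpace : HST → FiniteMetricSpace ℝ
  leafSpace T = record
    { size     = numLeaves tree
    ; d        = λ i j → pathDistance weight (at i) (at j)
    ; isMetric = record
      { isSemiMetric = record
        { isQuasiSemiMetric = record
          { isPreMetric = record
            { isProtoMetric = record
              { isPartialOrder  = ≤-isPartialOrder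
              ; ≈-isEquivalence = ≡.isEquivalence
              ; cong            = λ { ≡.refl ≡.refl → refl }
              ; nonNegative     = λ {i} {j} → pathDistance-nonneg weight>0 (at i) (at j)
              }
            ; ≈⇒0 = λ { {i} ≡.refl → pathDistance-refl weight>0 (at i) }
            }
          ; 0⇒≈ = λ {i} {j} eq → Injection.injective (Inverse⇒Injection (enumerateLeaves tree))
                                   (pathDistance≈0⇒≡ weight>0 (at i) (at j) eq)
          }
        ; sym = λ i j → pathDistance-sym weight>0 (at i) (at j)
        }
      ; triangle = λ i j k → pathDistance-triangle weight>0 (at i) (at j) (at k)
      }
    }
    where
    open HST T
    at : Fin (numLeaves tree) → Leaf tree
    at = Inverse.to (enumerateLeaves tree)

{-# OPTIONS --safe #-}

-- Symbols of level 0 are the request types.  From n ≥ 4 symbols one gets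
-- n + 1 symbols of the next level, pairs (possibly degenerate) of old ones, such
-- that no pair contains another.  The word of a pair repeats the words of
-- its two members so often that a subtree all of whose children lack one of
-- the two members pays as much as for leaving it, whereas a child with both
-- members serves the word cheaply, as the weights grow fast with the level.
-- Hence on a tall enough tree four request types simulate arbitrarily many
-- requests, "the current child of the root offers the symbol e", for any
-- prescribed sets of symbols.
--
-- Let there be two symbols for each of the k bits, and let the children of
-- the root correspond to the bit strings in {0,1}ᵏ.  Requesting a uniformly
-- random value for each bit in turn costs an online algorithm at least half
-- the diameter per bit in expectation, as each state disagrees with one of
-- the two values; offline, one move to the right child suffices for all k
-- bits, so the ratio grows linearly in k.

module Submission where

open import Defs
open import Algebra.Bundles using (CommutativeRing)
open import Data.Bool using (Bool; true; false; _∧_; _∨_)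
import Data.Bool as Bool
open import Data.Bool.Properties using (∨-zeroʳ)
open import Data.Empty using (⊥)
open import Data.Fin using (Fin; zero; suc; _≟_; _↑ˡ_; _↑ʳ_; splitAt; combine; remQuot; finToFun; funToFin)
open import Data.Fin.Patterns using (0F; 1F; 2F; 3F; 4F)
open import Data.Fin.Properties using (all?; splitAt-↑ˡ; splitAt-↑ʳ; remQuot-combine; finToFun-funToFin)
open import Data.Fin.Subset using (Subset; Nonempty; _∈_)
open import Data.Fin.Subset.Properties using (_∈?_)
open import Data.List using (List; []; _∷_; _++_; concat; replicate; tabulate; length)
open import Data.List.Properties using (++-assoc; ++-identityʳ; length-++; length-tabulate)
open import Data.List.Relation.Unary.All using (All; []; _∷_)
open import Data.List.Relation.Unary.All.Properties using (concat⁺; replicate⁺; tabulate⁺)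
open import Data.Nat as ℕ using (ℕ; zero; suc; pred; z≤n; s≤s; _∸_; _^_)
import Data.Nat.Properties as ℕₚ
open import Data.Nat.Solver using (module +-*-Solver)
open import Data.Product using (Σ-syntax; ∃; ∃-syntax; _×_; _,_; proj₁; proj₂)
open import Data.Sum using (_⊎_; inj₁; inj₂)
import Data.Vec as Vec
import Data.Vec.Functional as Vector
open import Data.Vec.Properties using (lookup∘tabulate; []=⇒lookup; lookup⇒[]=)
open import Function using (_∘_; Inverse)
open import Function.Metric.Structures using (IsGeneralMetric)
open import Relation.Binary.Bundles using (Poset)
open import Relation.Binary.PropositionalEquality as ≡ using (_≡_; _≢_; _≗_; subst)
open import Relation.Nullary using (¬_; yes; no; does; contradiction)
open import Relation.Nullary.Decidable using (_→-dec_; from-yes; dec-true)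

-- Pairs of symbols, gadget trees and their words.

module Combinatorics where
  open import Data.Nat using (_≤_)
  open import Data.Nat.Properties hiding (_≟_)
  open ≡ using (refl; sym; trans; cong; cong₂; module ≡-Reasoning)

  -- Five distinct pairs of four symbols; every further symbol is turned
  -- into the singleton pair consisting of itself.
  lo hi : ∀ n → Fin (5 ℕ.+ n) → Fin (4 ℕ.+ n)
  lo zero 0F = 0F
  lo zero 1F = 0F
  lo zero 2F = 0F
  lo zero 3F = 1F
  lo zero 4F = 1F
  lo (suc n) zero    = zero
  lo (suc n) (suc i) = suc (lo n i)
  hi zero 0F = 1F
  hi zero 1F = 2F
  hi zero 2F = 3F
  hi zero 3F = 2F
  hi zero 4F = 3F
  hi (suc n) zero    = zero
  hi (suc n) (suc i) = suc (hi n i)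

  inPair : ∀ n → Fin (5 ℕ.+ n) → Fin (4 ℕ.+ n) → Bool
  inPair n i a = does (a ≟ lo n i) ∨ does (a ≟ hi n i)

  lo-inPair : ∀ n i → inPair n i (lo n i) ≡ true
  lo-inPair n i rewrite dec-true (lo n i ≟ lo n i) refl = refl

  hi-inPair : ∀ n i → inPair n i (hi n i) ≡ true
  hi-inPair n i rewrite dec-true (hi n i ≟ hi n i) refl = ∨-zeroʳ (does (hi n i ≟ lo n i))

  -- The five initial pairs are distinct two-element sets, compared by evaluation; the singleton
  -- pair added at each step is disjoint from the shifted ones.
  pairs-antichain : ∀ n i j → inPair n i (lo n j) ≡ true → inPair n i (hi n j) ≡ true → i ≡ j
  pairs-antichain zero = from-yes (all? λ i → all? λ j →
    (inPair 0 i (lo 0 j) Bool.≟ true) →-dec ((inPair 0 i (hi 0 j) Bool.≟ true) →-dec (i ≟ j)))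
  pairs-antichain (suc n) zero    zero    _ _ = refl
  pairs-antichain (suc n) zero    (suc j) () _
  pairs-antichain (suc n) (suc i) zero    () _
  pairs-antichain (suc n) (suc i) (suc j) p q = cong suc (pairs-antichain n i j p q)

  pairs-cover : ∀ n a → ∃[ i ] inPair n i a ≡ true
  pairs-cover zero 0F = 0F , refl
  pairs-cover zero 1F = 0F , refl
  pairs-cover zero 2F = 1F , refl
  pairs-cover zero 3F = 2F , refl
  pairs-cover (suc n) zero    = zero , refl
  pairs-cover (suc n) (suc a) with i , p ← pairs-cover n a = suc i , p

  -- One child for each of the `5 + (l + q)` symbols of level `suc l`; the symbols of level `0` are
  -- the `4 + q` request types.
  gadget : ∀ q l → Tree l
  gadget q zero    = leaf
  gadget q (suc l) = node (4 ℕ.+ (l ℕ.+ q)) (λ _ → gadget q l)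

  childSymbols : ∀ n → (Fin (5 ℕ.+ n) → Bool) → Fin (5 ℕ.+ n) → Fin (4 ℕ.+ n) → Bool
  childSymbols n P i a = P i ∧ inPair n i a

  offers : ∀ q l → (Fin (4 ℕ.+ (l ℕ.+ q)) → Bool) → Leaf (gadget q l) → Fin (4 ℕ.+ q) → Bool
  offers q zero    P root        r = P r
  offers q (suc l) P (below i x) r = offers q l (childSymbols (l ℕ.+ q) P i) x r

  childSymbols⁺ : ∀ n P i a → P i ≡ true → inPair n i a ≡ true → childSymbols n P i a ≡ true
  childSymbols⁺ n P i a p q rewrite p = q

  -- Climbs from `r` through pairs that contain the symbol found so far. The resulting `e` does not
  -- depend on `P`, so only `P e` has to be arranged later.
  offers-cover : ∀ q l r → ∃[ e ] ∀ P → P e ≡ true → ∃[ x ] offers q l P x r ≡ true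
  offers-cover q zero    r = r , λ P Pr → root , Pr
  offers-cover q (suc l) r with offers-cover q l r
  ... | a , leafFor with pairs-cover (l ℕ.+ q) a
  ...   | i , a∈i = i , λ P Pi →
    let x , ok = leafFor _ (childSymbols⁺ (l ℕ.+ q) P i a Pi a∈i) in below i x , ok

  word : ∀ q (B : ℕ) l → Fin (4 ℕ.+ (l ℕ.+ q)) → List (Fin (4 ℕ.+ q))
  word q B zero    e = e ∷ []
  word q B (suc l) e =
    concat (replicate B (word q B l (lo (l ℕ.+ q) e) ++ word q B l (hi (l ℕ.+ q) e)))

  firstLeaf : ∀ {l} (t : Tree l) → Leaf t
  firstLeaf leaf              = root
  firstLeaf (node k children) = below zero (firstLeaf (children zero))

  -- Twice the depth `B ^ l` of a node of level `suc l`: the distance between leaves below two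
  -- different children of it.
  gap : ℕ → ℕ → ℕ
  gap B l = 2 ℕ.* B ^ l

  *-gap : ∀ B l → B ℕ.* gap B l ≡ gap B (suc l)
  *-gap B l = solve 2 (λ x y → x :* (con 2 :* y) := con 2 :* (x :* y)) refl B (B ^ l)
    where open +-*-Solver

  wordCost : ℕ → ℕ → ℕ
  wordCost B zero    = 0
  wordCost B (suc l) = gap B l ℕ.+ B ℕ.* (wordCost B l ℕ.+ wordCost B l)

  wordCostFactor : ℕ → ℕ
  wordCostFactor zero    = 0
  wordCostFactor (suc l) = 2 ℕ.+ 2 ℕ.* wordCostFactor l

  -- The coefficient does not involve `B`, so for large `B` a word costs little compared with
  -- `gap B l`.
  *-wordCost : ∀ B l → B ℕ.* wordCost B l ≡ wordCostFactor l ℕ.* B ^ l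
  *-wordCost B zero    = *-zeroʳ B
  *-wordCost B (suc l) = begin
    B ℕ.* (gap B l ℕ.+ B ℕ.* (c ℕ.+ c))
      ≡⟨ solve 3 (λ B x c → B :* (con 2 :* x :+ B :* (c :+ c)) :=
                            con 2 :* (B :* x) :+ con 2 :* B :* (B :* c)) refl B x c ⟩
    2 ℕ.* (B ℕ.* x) ℕ.+ 2 ℕ.* B ℕ.* (B ℕ.* c)
      ≡⟨ cong (λ z → 2 ℕ.* (B ℕ.* x) ℕ.+ 2 ℕ.* B ℕ.* z) (*-wordCost B l) ⟩
    2 ℕ.* (B ℕ.* x) ℕ.+ 2 ℕ.* B ℕ.* (y ℕ.* x)
      ≡⟨ solve 3 (λ B x y → con 2 :* (B :* x) :+ con 2 :* B :* (y :* x) :=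
                            (con 2 :+ con 2 :* y) :* (B :* x)) refl B x y ⟩
    (2 ℕ.+ 2 ℕ.* y) ℕ.* (B ℕ.* x) ∎
    where
    open ≡-Reasoning
    open +-*-Solver
    c x y : ℕ
    c = wordCost B l
    x = B ^ l
    y = wordCostFactor l

  -- Integer distances between leaves.

  module _ (B : ℕ) where

    -- Integer-valued, so that the service arguments use a decidable order; `pathDistance≈`
    -- identifies it with the real distance.
    leafDistance : ∀ {l} {t : Tree l} → Leaf t → Leaf t → ℕ
    leafDistance root root = 0
    leafDistance {suc l} (below i x) (below j y) with i ≟ j
    ... | yes refl = leafDistance x y
    ... | no _     = gap B l

    leafDistance-below : ∀ {l k} {children : Fin (suc k) → Tree l} i (x y : Leaf (children i)) →
                         leafDistance {t = node k children} (below i x) (below i y) ≡ leafDistance x y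
    leafDistance-below i x y with i ≟ i
    ... | yes refl = refl
    ... | no i≢i   = contradiction refl i≢i

    leafDistance-apart : ∀ {l k} {children : Fin (suc k) → Tree l} {i j} →
                         i ≢ j → (x : Leaf (children i)) (y : Leaf (children j)) →
                         leafDistance {t = node k children} (below i x) (below j y) ≡ gap B l
    leafDistance-apart {i = i} {j} i≢j x y with i ≟ j
    ... | yes i≡j = contradiction i≡j i≢j
    ... | no _    = refl

  module _ (b : ℕ) where
    private
      B : ℕ
      B = suc b

    gap-mono : ∀ l → gap B l ≤ gap B (suc l)
    gap-mono l = *-monoʳ-≤ 2 (m≤n*m (B ^ l) B)

    leafDistance≤gap : ∀ {l} {t : Tree l} (x y : Leaf t) → leafDistance B x y ≤ gap B (pred l)
    leafDistance≤gap root root = z≤n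
    leafDistance≤gap {suc l} (below i x) (below j y) with i ≟ j
    ... | yes refl = ≤-trans (leafDistance≤gap x y) (gap-pred l)
      where
      gap-pred : ∀ l → gap B (pred l) ≤ gap B l
      gap-pred zero    = ≤-refl
      gap-pred (suc l) = gap-mono l
    ... | no _     = ≤-refl

  -- Service paths with integer costs.

  module Service {m : ℕ} {X : Set} (dist : X → X → ℕ) (Serves : Fin m → X → Set) where

    Path : List (Fin m) → Set
    Path = All (λ r → ∃ (Serves r))

    travel : X → ∀ {ρ} → Path ρ → ℕ
    travel s []             = 0
    travel s ((x , _) ∷ xs) = dist s x ℕ.+ travel x xs

    CostsAtLeast CostsAtMost : X → List (Fin m) → ℕ → Set
    CostsAtLeast s ρ v = ∀ (xs : Path ρ) → v ≤ travel s xs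
    CostsAtMost  s ρ v = Σ[ xs ∈ Path ρ ] travel s xs ≤ v

    -- Descent on the integer cost. The double negation suffices because the result serves to prove
    -- an inequality of reals, which is itself a negation.
    ¬¬-optimalPath : ∀ s {ρ} → Path ρ → ¬ ¬ (Σ[ xs ∈ Path ρ ] CostsAtLeast s ρ (travel s xs))
    ¬¬-optimalPath s {ρ} path none = descend (suc (travel s path)) path ≤-refl
      where
      descend : ∀ n (xs : Path ρ) → ¬ travel s xs ℕ.< n
      descend (suc n) xs (ℕ.s≤s xs≤n) =
        none (xs , λ ys → ≮⇒≥ λ ys<xs → descend n ys (≤-trans ys<xs xs≤n))

    costsAtLeast-++ : ∀ {s v} ρ ρ′ → CostsAtLeast s ρ v → CostsAtLeast s (ρ ++ ρ′) v
    costsAtLeast-++ []      ρ′ low xs = ≤-trans (low []) z≤n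
    costsAtLeast-++ {s} {v} (r ∷ ρ) ρ′ low ((x , x∈) ∷ xs) =
      ≤-trans (m≤n+m∸n v (dist s x)) (+-monoʳ-≤ (dist s x) (costsAtLeast-++ ρ ρ′ rest xs))
      where
      rest : CostsAtLeast x ρ (v ∸ dist s x)
      rest ys = m≤n+o⇒m∸n≤o v (dist s x) (low ((x , x∈) ∷ ys))

    -- Leaving the ball already costs u + v; a path staying inside pays u for
    -- ρ and then v for ρ′.
    costsAtLeast-ball : ∀ {Y : Set} (ι : Y → X) {u v} →
      (∀ z → (∃[ y ] z ≡ ι y) ⊎ (∀ y → u ℕ.+ v ≤ dist (ι y) z)) →
      ∀ {s} ρ {ρ′} → CostsAtLeast (ι s) ρ u → (∀ t → CostsAtLeast (ι t) ρ′ v) →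
      CostsAtLeast (ι s) (ρ ++ ρ′) (u ℕ.+ v)
    costsAtLeast-ball ι {v = v} ball {s} [] low low′ xs =
      ≤-trans (+-monoˡ-≤ v (low [])) (low′ s xs)
    costsAtLeast-ball ι {u} {v} ball {s} (r ∷ ρ) low low′ ((x , x∈) ∷ xs) with ball x
    ... | inj₂ far         = ≤-trans (far s) (m≤m+n (dist (ι s) x) (travel x xs))
    ... | inj₁ (y , refl) = begin
      u ℕ.+ v              ≤⟨ +-monoˡ-≤ v (m≤n+m∸n u δ) ⟩
      δ ℕ.+ (u ∸ δ) ℕ.+ v  ≡⟨ +-assoc δ (u ∸ δ) v ⟩
      δ ℕ.+ (u ∸ δ ℕ.+ v)  ≤⟨ +-monoʳ-≤ δ (costsAtLeast-ball ι ball′ ρ rest low′ xs) ⟩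
      δ ℕ.+ travel x xs    ∎
      where
      open ≤-Reasoning
      δ : ℕ
      δ = dist (ι s) x
      rest : CostsAtLeast x ρ (u ∸ δ)
      rest ys = m≤n+o⇒m∸n≤o u δ (low ((x , x∈) ∷ ys))
      ball′ : ∀ z → (∃[ y ] z ≡ ι y) ⊎ (∀ y → u ∸ δ ℕ.+ v ≤ dist (ι y) z)
      ball′ z with ball z
      ... | inj₁ in-ball = inj₁ in-ball
      ... | inj₂ far     = inj₂ λ y → ≤-trans (+-monoˡ-≤ v (m∸n≤m u δ)) (far y)

    module _ (triangle : ∀ x y z → dist x z ≤ dist x y ℕ.+ dist y z) where

      costsAtMost-from : ∀ {s s′ δ v} ρ → dist s s′ ≤ δ → CostsAtMost s′ ρ v → CostsAtMost s ρ (δ ℕ.+ v)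
      costsAtMost-from [] near ([] , _) = [] , z≤n
      costsAtMost-from {s} {s′} {δ} {v} (r ∷ ρ) near ((x , x∈) ∷ xs , le) = (x , x∈) ∷ xs , (begin
        dist s x ℕ.+ travel x xs                   ≤⟨ +-monoˡ-≤ (travel x xs) (triangle s s′ x) ⟩
        dist s s′ ℕ.+ dist s′ x ℕ.+ travel x xs    ≡⟨ +-assoc (dist s s′) (dist s′ x) (travel x xs) ⟩
        dist s s′ ℕ.+ (dist s′ x ℕ.+ travel x xs)  ≤⟨ +-mono-≤ near le ⟩
        δ ℕ.+ v                                    ∎)
        where open ≤-Reasoning

  -- Cost of a word in an embedded gadget.

  module Embedding (b q : ℕ) {X : Set} (dist : X → X → ℕ) (Serves : Fin (4 ℕ.+ q) → X → Set) where
    open Service dist Serves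

    private
      B : ℕ
      B = suc b

    -- A copy of the gadget in a fixed ambient space, with `P` the symbols offered at its root.
    -- Induction can pass to subtrees while paths remain free to leave them; `ball` prices leaving
    -- as crossing a node one level up.
    record Embedded (l : ℕ) (P : Fin (4 ℕ.+ (l ℕ.+ q)) → Bool) : Set where
      field
        ι       : Leaf (gadget q l) → X
        dist-ι  : ∀ x y → dist (ι x) (ι y) ≡ leafDistance B x y
        serves⇒ : ∀ x r → Serves r (ι x) → offers q l P x r ≡ true
        serves⇐ : ∀ x r → offers q l P x r ≡ true → Serves r (ι x)
        ball    : ∀ z → (∃[ y ] z ≡ ι y) ⊎ (∀ y → gap B l ≤ dist (ι y) z)

    open Embedded

    -- Isolation is inherited: leaves of a sibling are at distance exactly `gap B l`, and points
    -- outside the parent are at least `gap B (suc l)` away, which is no smaller.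
    child : ∀ {l P} → Embedded (suc l) P → ∀ i → Embedded l (childSymbols (l ℕ.+ q) P i)
    child E i .ι y                 = ι E (below i y)
    child {l} E i .dist-ι x y      =
      trans (dist-ι E (below i x) (below i y)) (leafDistance-below B {children = λ _ → gadget q l} i x y)
    child E i .serves⇒ x r         = serves⇒ E (below i x) r
    child E i .serves⇐ x r         = serves⇐ E (below i x) r
    child {l} E i .ball z with ball E z
    ... | inj₂ far = inj₂ λ y → ≤-trans (gap-mono b l) (far (below i y))
    ... | inj₁ (below j y , z≡) with i ≟ j
    ...   | yes refl = inj₁ (y , z≡)
    ...   | no i≢j   = inj₂ λ x → ≤-reflexive (sym (trans (cong (dist (ι E (below i x))) z≡)
                         (trans (dist-ι E (below i x) (below j y)) (leafDistance-apart B i≢j x y))))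

    -- Leaving the copy costs `gap B (suc l)`, that is `B` times `gap B l`, so it saves nothing
    -- against paying for each of at most `B` rounds inside.
    costsAtLeast-repeat : ∀ {l P} (E : Embedded (suc l) P) w →
      (∀ s → CostsAtLeast (ι E s) w (gap B l)) →
      ∀ n → n ≤ B → ∀ s → CostsAtLeast (ι E s) (concat (replicate n w)) (n ℕ.* gap B l)
    costsAtLeast-repeat E w low zero    _   s xs = z≤n
    costsAtLeast-repeat {l} E w low (suc n) n<B s =
      costsAtLeast-ball (ι E) ball′ w (low s) (costsAtLeast-repeat E w low n (<⇒≤ n<B))
      where
      ball′ : ∀ z → (∃[ y ] z ≡ ι E y) ⊎ (∀ y → suc n ℕ.* gap B l ≤ dist (ι E y) z)
      ball′ z with ball E z
      ... | inj₁ in-ball = inj₁ in-ball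
      ... | inj₂ far     = inj₂ λ y →
        ≤-trans (*-monoˡ-≤ (gap B l) n<B) (≤-trans (≤-reflexive (*-gap B l)) (far y))

    -- By the antichain property only child `e` could offer both members of pair `e`, and it offers
    -- nothing without `P e`. So every child lacks a member, each round costs `gap B l` by
    -- induction, and `B` rounds amount to `gap B (suc l)`.
    word-costsAtLeast : ∀ l {P} (E : Embedded l P) e → P e ≡ false →
                        ∀ s → CostsAtLeast (ι E s) (word q B l e) (gap B l)
    word-costsAtLeast zero {P} E e ¬Pe root ((x , x∈) ∷ []) with ball E x
    ... | inj₂ far = ≤-trans (far root) (m≤m+n _ _)
    ... | inj₁ (root , refl) with () ← trans (sym (serves⇒ E root e x∈)) ¬Pe
    word-costsAtLeast (suc l) {P} E e ¬Pe s =
      subst (CostsAtLeast (ι E s) (word q B (suc l) e)) (*-gap B l)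
        (costsAtLeast-repeat E (word q B l a ++ word q B l a′) once B ≤-refl s)
      where
      n : ℕ
      n = l ℕ.+ q
      a a′ : Fin (4 ℕ.+ n)
      a = lo n e
      a′ = hi n e
      missing : ∀ i → childSymbols n P i a ≡ false ⊎ childSymbols n P i a′ ≡ false
      missing i with P i in Pi
      ... | false = inj₁ refl
      ... | true with inPair n i a in a∈i | inPair n i a′ in a′∈i
      ...   | false | _     = inj₁ refl
      ...   | true  | false = inj₂ refl
      ...   | true  | true with refl ← pairs-antichain n i e a∈i a′∈i with () ← trans (sym Pi) ¬Pe
      once : ∀ s → CostsAtLeast (ι E s) (word q B l a ++ word q B l a′) (gap B l)
      once (below i x) with missing i
      ... | inj₁ ¬a  = costsAtLeast-++ (word q B l a) (word q B l a′)
                         (word-costsAtLeast l (child E i) a ¬a x)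
      -- The first word is credited with `0`: it may shift the state within the child, but the bound
      -- for the second word holds from every leaf there.
      ... | inj₂ ¬a′ = costsAtLeast-ball (ι (child E i)) (ball (child E i)) (word q B l a)
                         (λ _ → z≤n) (word-costsAtLeast l (child E i) a′ ¬a′)

    module _ (triangle : ∀ x y z → dist x z ≤ dist x y ℕ.+ dist y z) where

      -- The continuation `ρ` has a bound from every leaf, so the state reached after the word need
      -- not be tracked. The move into child `e` is paid once; that child has both members, so all
      -- rounds stay inside it.
      word-costsAtMost : ∀ l {P} (E : Embedded l P) e → P e ≡ true → ∀ {ρ v} →
        (∀ t → CostsAtMost (ι E t) ρ v) →
        ∀ s → CostsAtMost (ι E s) (word q B l e ++ ρ) (wordCost B l ℕ.+ v)
      word-costsAtMost zero E e Pe up root with xs , le ← up root =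
        (ι E root , serves⇐ E root e Pe) ∷ xs ,
        ≤-trans (≤-reflexive (cong (ℕ._+ travel (ι E root) xs) (dist-ι E root root))) le
      word-costsAtMost (suc l) {P} E e Pe {ρ} {v} up s =
        subst (CostsAtMost (ι E s) (word q B (suc l) e ++ ρ)) (sym (+-assoc (gap B l) _ v))
          (costsAtMost-from triangle _ near (rounds B y₀))
        where
        n : ℕ
        n = l ℕ.+ q
        w w′ : List (Fin (4 ℕ.+ q))
        w = word q B l (lo n e)
        w′ = word q B l (hi n e)
        y₀ : Leaf (gadget q l)
        y₀ = firstLeaf (gadget q l)
        near : dist (ι E s) (ι (child E e) y₀) ≤ gap B l
        near = ≤-trans (≤-reflexive (dist-ι E s (below e y₀))) (leafDistance≤gap b s (below e y₀))
        c : ℕ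
        c = wordCost B l
        rounds : ∀ j y → CostsAtMost (ι (child E e) y) (concat (replicate j (w ++ w′)) ++ ρ)
                           (j ℕ.* (c ℕ.+ c) ℕ.+ v)
        rounds zero    y = up (below e y)
        rounds (suc j) y
          rewrite ++-assoc (w ++ w′) (concat (replicate j (w ++ w′))) ρ
                | ++-assoc w w′ (concat (replicate j (w ++ w′)) ++ ρ)
                | +-assoc (c ℕ.+ c) (j ℕ.* (c ℕ.+ c)) v
                | +-assoc c c (j ℕ.* (c ℕ.+ c) ℕ.+ v) =
          word-costsAtMost l (child E e) (lo n e) (childSymbols⁺ n P e (lo n e) Pe (lo-inPair n e))
            (word-costsAtMost l (child E e) (hi n e) (childSymbols⁺ n P e (hi n e) Pe (hi-inPair n e))
              (rounds j)) y

      words-costsAtMost : ∀ {l P} (E : Embedded l P) {n} (e : Fin n → Fin (4 ℕ.+ (l ℕ.+ q))) →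
        (∀ j → P (e j) ≡ true) → ∀ {ρ v} → (∀ t → CostsAtMost (ι E t) ρ v) →
        ∀ s → CostsAtMost (ι E s) (concat (tabulate (λ j → word q B l (e j))) ++ ρ)
                (n ℕ.* wordCost B l ℕ.+ v)
      words-costsAtMost     E {zero}  e Pe up = up
      words-costsAtMost {l} E {suc n} e Pe {ρ} {v} up s
        rewrite ++-assoc (word q B l (e zero)) (concat (tabulate (λ j → word q B l (e (suc j))))) ρ
              | +-assoc (wordCost B l) (n ℕ.* wordCost B l) v =
        word-costsAtMost l E (e zero) (Pe zero)
          (words-costsAtMost E (λ j → e (suc j)) (λ j → Pe (suc j)) up) s

  -- Request sequences arising from choices of bits.

  data Outcome {A : Set} : List (Fin 2 → List A) → List A → Set where
    []   : Outcome [] []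
    pick : ∀ {p ps ρ} β → Outcome ps ρ → Outcome (p ∷ ps) (p β ++ ρ)

  -- Recovers the bit string `f` of one phase, which later addresses the child used offline.
  outcome-tabulate : ∀ {A : Set} {n} (p : Fin n → Fin 2 → List A) {ps ρ} →
    Outcome (tabulate p ++ ps) ρ →
    Σ[ f ∈ (Fin n → Fin 2) ] ∃[ ρ′ ] Outcome ps ρ′ × ρ ≡ concat (tabulate (λ j → p j (f j))) ++ ρ′
  outcome-tabulate {n = zero}  p o = (λ ()) , _ , o , refl
  outcome-tabulate {n = suc n} p (pick β o) with outcome-tabulate (λ j → p (suc j)) o
  ... | f , ρ′ , o′ , refl = (β Vector.∷ f) , ρ′ , o′ , sym (++-assoc (p zero β) _ ρ′)

  -- The tree and the request types for `k` bits.

  module Hard (q k : ℕ) where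

    -- Each level adds one symbol to the initial `4 + q`, so this height yields two further symbols
    -- for each of the `k` bits.
    L : ℕ
    L = k ℕ.* 2

    -- The product lets the `k` words of a phase cost at most `gap B L`; the summand `2` makes
    -- `B - 1` positive, which is a factor of the edge weights above the lowest level.
    B : ℕ
    B = 2 ℕ.+ k ℕ.* wordCostFactor L

    symbol : Fin k → Fin 2 → Fin (4 ℕ.+ (L ℕ.+ q))
    symbol j β = 4 ↑ʳ (combine j β ↑ˡ q)

    agrees : (Fin k → Fin 2) → Fin k × Fin 2 → Bool
    agrees f (j , β) = does (β ≟ f j)

    -- The symbols that encode no bit are always offered; this makes every
    -- request type non-empty.
    selected : (Fin k → Fin 2) → Fin (4 ℕ.+ (L ℕ.+ q)) → Bool
    selected f e with splitAt 4 e
    ... | inj₁ _ = true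
    ... | inj₂ e′ with splitAt L e′
    ...   | inj₂ _ = true
    ...   | inj₁ i = agrees f (remQuot 2 i)

    selected-cong : ∀ {f g} → f ≗ g → selected f ≗ selected g
    selected-cong f≗g e with splitAt 4 e
    ... | inj₁ _ = refl
    ... | inj₂ e′ with splitAt L e′
    ...   | inj₂ _ = refl
    ...   | inj₁ i = cong (λ γ → does (proj₂ (remQuot {k} 2 i) ≟ γ)) (f≗g (proj₁ (remQuot {k} 2 i)))

    selected-symbol : ∀ f j β → selected f (symbol j β) ≡ does (β ≟ f j)
    selected-symbol f j β
      rewrite splitAt-↑ʳ 4 (L ℕ.+ q) (combine j β ↑ˡ q)
            | splitAt-↑ˡ L (combine j β) q
            = cong (agrees f) (remQuot-combine j β)

    selected-cover : ∀ e → ∃[ f ] selected f e ≡ true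
    selected-cover e with splitAt 4 e
    ... | inj₁ _ = (λ _ → zero) , refl
    ... | inj₂ e′ with splitAt L e′
    ...   | inj₂ _ = (λ _ → zero) , refl
    ...   | inj₁ i = let β = proj₂ (remQuot {k} 2 i) in (λ _ → β) , dec-true (β ≟ β) refl

    tree : Tree (suc L)
    tree = node (2 ^ k) (λ _ → gadget q L)

    -- A node must have a child, so there is a dummy first one.
    symbols : Fin (suc (2 ^ k)) → Fin (4 ℕ.+ (L ℕ.+ q)) → Bool
    symbols zero    e = false
    symbols (suc i) e = selected (finToFun i) e

    provides : Leaf tree → Fin (4 ℕ.+ q) → Bool
    provides (below i x) r = offers q L (symbols i) x r

    Point : Set
    Point = Fin (numLeaves tree)

    open Inverse (enumerateLeaves tree) using (to; from; strictlyInverseˡ; strictlyInverseʳ)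

    dist : Point → Point → ℕ
    dist x y = leafDistance B (to x) (to y)

    K : Fin (4 ℕ.+ q) → Subset (numLeaves tree)
    K r = Vec.tabulate (λ x → provides (to x) r)

    K⇒provides : ∀ {r x} → x ∈ K r → provides (to x) r ≡ true
    K⇒provides {x = x} x∈ = trans (sym (lookup∘tabulate _ x)) ([]=⇒lookup x∈)

    provides⇒K : ∀ {r x} → provides (to x) r ≡ true → x ∈ K r
    provides⇒K {r} {x} ok = lookup⇒[]= x (K r) (trans (lookup∘tabulate _ x) ok)

    provides⇒K-from : ∀ {r} y → provides y r ≡ true → from y ∈ K r
    provides⇒K-from {r} y ok =
      provides⇒K (trans (cong (λ z → provides z r) (strictlyInverseˡ y)) ok)

    K-nonempty : ∀ r → Nonempty (K r)
    K-nonempty r with e , leafFor ← offers-cover q L r with f , fe ← selected-cover e =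
      let c = suc (funToFin f)
          x , ok = leafFor (symbols c) (trans (selected-cong (finToFun-funToFin f) e) fe)
      in from (below c x) , provides⇒K-from (below c x) ok

    open Embedding (suc (k ℕ.* wordCostFactor L)) q dist (λ r x → x ∈ K r) public
    open Service dist (λ r x → x ∈ K r) public

    subtree : ∀ c → Embedded L (symbols c)
    subtree c .Embedded.ι y          = from (below c y)
    subtree c .Embedded.dist-ι x y   =
      trans (cong₂ (leafDistance B) (strictlyInverseˡ (below c x)) (strictlyInverseˡ (below c y)))
        (leafDistance-below B {children = λ _ → gadget q L} c x y)
    subtree c .Embedded.serves⇒ x r x∈ =
      trans (cong (λ z → provides z r) (sym (strictlyInverseˡ (below c x)))) (K⇒provides x∈)
    subtree c .Embedded.serves⇐ x r  = provides⇒K-from (below c x)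
    subtree c .Embedded.ball z with to z in to-z
    ... | below c′ y with c ≟ c′
    ...   | yes refl = inj₁ (y , trans (sym (strictlyInverseʳ z)) (cong from to-z))
    ...   | no c≢c′  = inj₂ λ x → ≤-reflexive (sym (trans
      (cong₂ (leafDistance B) (strictlyInverseˡ (below c x)) to-z)
      (leafDistance-apart B {children = λ _ → gadget q L} c≢c′ x y)))

    bit : Fin k → Fin 2 → List (Fin (4 ℕ.+ q))
    bit j β = word q B L (symbol j β)

    -- A child carries one value per bit and does not offer the symbol of the opposite value. For
    -- the dummy child any value will do.
    wrong-bit : ∀ c j → ∃[ β ] symbols c (symbol j β) ≡ false
    wrong-bit zero    j = zero , refl
    wrong-bit (suc i) j with finToFun {2} {k} i j in fj
    ... | zero     = suc zero , trans (selected-symbol (finToFun i) j (suc zero)) (cong (does ∘ (suc zero ≟_)) fj)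
    ... | suc zero = zero , trans (selected-symbol (finToFun i) j zero) (cong (does ∘ (zero ≟_)) fj)

    wrong-bit-costs : ∀ j s → ∃[ β ] CostsAtLeast s (bit j β) (gap B L)
    wrong-bit-costs j s with to s in to-s
    ... | below c y with wrong-bit c j
    ...   | β , ¬c = β , subst (λ s → CostsAtLeast s (bit j β) (gap B L))
      (trans (cong from (sym to-s)) (strictlyInverseʳ s))
      (word-costsAtLeast L (subtree c) (symbol j β) ¬c y)

    phase : List (Fin 2 → List (Fin (4 ℕ.+ q)))
    phase = tabulate bit

    phases : ℕ → List (Fin 2 → List (Fin (4 ℕ.+ q)))
    phases n = concat (replicate n phase)

    -- One gap to enter the child that offers all symbols of the phase, and one to cover its `k`
    -- words.
    phaseCost : ℕ
    phaseCost = gap B L ℕ.+ gap B L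

    -- After multiplication by `B`, the left side is `k * wordCostFactor L * B ^ L` by `*-wordCost`,
    -- and `B` was chosen above `k * wordCostFactor L`.
    phase-words≤gap : k ℕ.* wordCost B L ≤ gap B L
    phase-words≤gap = *-cancelˡ-≤ B (begin
      B ℕ.* (k ℕ.* wordCost B L)                  ≡⟨ x∙yz≈y∙xz B k (wordCost B L) ⟩
      k ℕ.* (B ℕ.* wordCost B L)                  ≡⟨ cong (k ℕ.*_) (*-wordCost B L) ⟩
      k ℕ.* (wordCostFactor L ℕ.* B ^ L)          ≡⟨ *-assoc k (wordCostFactor L) (B ^ L) ⟨
      k ℕ.* wordCostFactor L ℕ.* B ^ L            ≤⟨ *-mono-≤ (m≤n+m (k ℕ.* wordCostFactor L) 2) (m≤m+n (B ^ L) _) ⟩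
      B ℕ.* gap B L                               ∎)
      where
      open ≤-Reasoning
      open import Algebra.Properties.CommutativeSemigroup *-commutativeSemigroup using (x∙yz≈y∙xz)

    length-phases : ∀ n → length (phases n) ≡ n ℕ.* k
    length-phases zero    = refl
    length-phases (suc n) = trans (length-++ phase) (cong₂ ℕ._+_ (length-tabulate bit) (length-phases n))

    module _ (triangle : ∀ x y z → dist x z ≤ dist x y ℕ.+ dist y z) where

      -- Each phase moves once, to the child addressed by its own bit string `f`.
      phases-costsAtMost : ∀ n {ρ} → Outcome (phases n) ρ → ∀ s → CostsAtMost s ρ (n ℕ.* phaseCost)
      phases-costsAtMost zero    []  s = [] , z≤n
      phases-costsAtMost (suc n) o s with outcome-tabulate bit o
      ... | f , ρ , o′ , refl = subst (CostsAtMost s _) (sym (+-assoc (gap B L) _ _))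
        (costsAtMost-from triangle _ (leafDistance≤gap _ (to s) (to s′)) phase-costsAtMost)
        where
        c : Fin (suc (2 ^ k))
        c = suc (funToFin f)
        y₀ : Leaf (gadget q L)
        y₀ = firstLeaf (gadget q L)
        s′ : Point
        s′ = Embedded.ι (subtree c) y₀
        chosen : ∀ j → symbols c (symbol j (f j)) ≡ true
        chosen j = trans (selected-symbol _ j (f j)) (dec-true (f j ≟ _) (sym (finToFun-funToFin f j)))
        phase-costsAtMost : CostsAtMost s′ (concat (tabulate (λ j → bit j (f j))) ++ ρ)
                              (gap B L ℕ.+ n ℕ.* phaseCost)
        phase-costsAtMost with xs , le ← words-costsAtMost triangle (subtree c) (λ j → symbol j (f j)) chosen
                                (λ t → phases-costsAtMost n o′ (Embedded.ι (subtree c) t)) y₀ =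
          xs , ≤-trans le (+-monoˡ-≤ (n ℕ.* phaseCost) phase-words≤gap)

open Combinatorics

-- Order and natural multiples in the reals.

module Reals {c ℓ₁ ℓ₂} (ℝ : RealNumbers c ℓ₁ ℓ₂) where
  open RealNumbers ℝ hiding (zero)
  open CommutativeRing commutativeRing using (ring; semiring; +-commutativeSemigroup)
  open import Algebra.Properties.Ring ring using (-‿distribʳ-*; -‿involutive)
  open import Algebra.Properties.CommutativeSemigroup +-commutativeSemigroup using (interchange)
  open import Algebra.Properties.Semiring.Mult semiring using (×-homo-+; ×-congʳ; ×1-homo-*; ×-assoc-*)
  open import Algebra.Apartness.Properties.HeytingCommutativeRing heytingCommutativeRing using (1#0)

  ≤-poset : Poset c ℓ₁ ℓ₂
  ≤-poset = record { isPartialOrder = ≤-isPartialOrder }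

  open import Relation.Binary.Reasoning.PartialOrder ≤-poset public

  ≤-refl : ∀ {x} → x ≤ x
  ≤-refl = ≤-reflexive refl

  x<0⇒0<-x : ∀ {x} → x < 0# → 0# < - x
  x<0⇒0<-x {x} x<0 =
    <-respˡ-≈ (-‿inverseʳ x) (<-respʳ-≈ (+-identityˡ (- x)) (+-monoˡ-< (- x) x<0))

  0<1 : 0# < 1#
  0<1 with #⇒<⊎> 1#0
  ... | inj₂ 0<1 = 0<1
  ... | inj₁ 1<0 = <-respʳ-≈ -1*-1≈1 (*-positive 0<-1 0<-1)
    where
    0<-1 : 0# < - 1#
    0<-1 = x<0⇒0<-x 1<0
    -1*-1≈1 : - 1# * - 1# ≈ 1#
    -1*-1≈1 = trans (sym (-‿distribʳ-* (- 1#) 1#))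
      (trans (-‿cong (*-identityʳ (- 1#))) (-‿involutive 1#))

  +-monoʳ-≤ : ∀ z {x y} → x ≤ y → z + x ≤ z + y
  +-monoʳ-≤ z = +-mono-≤ ≤-refl

  +-cancelˡ-≤ : ∀ z {x y} → z + x ≤ z + y → x ≤ y
  +-cancelˡ-≤ z {x} {y} z+x≤z+y y<x =
    z+x≤z+y (<-respˡ-≈ (+-comm y z) (<-respʳ-≈ (+-comm x z) (+-monoˡ-< z y<x)))

  x-y+y≈x : ∀ x y → x - y + y ≈ x
  x-y+y≈x x y = trans (+-assoc x (- y) y) (trans (+-congˡ (-‿inverseˡ y)) (+-identityʳ x))

  *-nonneg : ∀ {x y} → 0# ≤ x → 0# ≤ y → 0# ≤ x * y
  *-nonneg {x} {y} 0≤x 0≤y xy<0 = x≰0 (≤-antisym x≤0 0≤x)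
    where
    x≰0 : ¬ x ≈ 0#
    x≰0 x≈0 = <-irrefl (trans (*-congʳ x≈0) (zeroˡ y)) xy<0
    y≉0 : ¬ y ≈ 0#
    y≉0 y≈0 = <-irrefl (trans (*-congˡ y≈0) (zeroʳ x)) xy<0
    x≤0 : x ≤ 0#
    x≤0 0<x = y≉0 (≤-antisym (λ 0<y → <-asym xy<0 (*-positive 0<x 0<y)) 0≤y)

  *-monoˡ-≤-nonneg : ∀ {z x y} → 0# ≤ z → x ≤ y → z * x ≤ z * y
  *-monoˡ-≤-nonneg {z} {x} {y} 0≤z x≤y = begin
    z * x                ≤⟨ x≤y+x (*-nonneg 0≤z 0≤y-x) ⟩
    z * (y - x) + z * x  ≈⟨ distribˡ z (y - x) x ⟨
    z * (y - x + x)      ≈⟨ *-congˡ (x-y+y≈x y x) ⟩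
    z * y                ∎
    where
    0≤y-x : 0# ≤ y - x
    0≤y-x = ≤-trans (≤-reflexive (sym (-‿inverseʳ x))) (+-monoˡ-≤ (- x) x≤y)

  sum-mono : ∀ {n} {f g : Fin n → Carrier} → (∀ i → f i ≤ g i) → sum f ≤ sum g
  sum-mono {zero}  f≤g = ≤-refl
  sum-mono {suc n} f≤g = +-mono-≤ (f≤g zero) (sum-mono (λ i → f≤g (suc i)))

  fromℕ : ℕ → Carrier
  fromℕ n = n · 1#

  fromℕ-homo-+ : ∀ m n → fromℕ (m ℕ.+ n) ≈ fromℕ m + fromℕ n
  fromℕ-homo-+ m n = ×-homo-+ 1# m n

  fromℕ-homo-* : ∀ m n → fromℕ (m ℕ.* n) ≈ fromℕ m * fromℕ n
  fromℕ-homo-* = ×1-homo-*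

  ·-fromℕ : ∀ m n → m · fromℕ n ≈ fromℕ (m ℕ.* n)
  ·-fromℕ m n = begin-equality
    m · fromℕ n         ≈⟨ ×-congʳ m (*-identityˡ (fromℕ n)) ⟨
    m · (1# * fromℕ n)  ≈⟨ ×-assoc-* m 1# (fromℕ n) ⟨
    fromℕ m * fromℕ n   ≈⟨ fromℕ-homo-* m n ⟨
    fromℕ (m ℕ.* n)     ∎

  fromℕ≥0 : ∀ n → 0# ≤ fromℕ n
  fromℕ≥0 zero    = ≤-refl
  fromℕ≥0 (suc n) = +-nonneg (<⇒≤ 0<1) (fromℕ≥0 n)

  fromℕ>0 : ∀ {n} → 0 ℕ.< n → 0# < fromℕ n
  fromℕ>0 {suc n} _ = +-positiveˡ 0<1 (fromℕ≥0 n)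

  fromℕ-mono : ∀ {m n} → m ℕ.≤ n → fromℕ m ≤ fromℕ n
  fromℕ-mono {m} m≤n with k , ≡.refl ← ℕₚ.m≤n⇒∃[o]m+o≡n m≤n =
    ≤-trans (x≤x+y (fromℕ≥0 k)) (≤-reflexive (sym (fromℕ-homo-+ m k)))

  fromℕ-cancel : ∀ {m n} → fromℕ m ≤ fromℕ n → m ℕ.≤ n
  fromℕ-cancel {m} {n} m≤n = ℕₚ.≮⇒≥ λ n<m → ≤-trans (fromℕ-mono n<m) m≤n
    (<-respˡ-≈ (+-identityˡ (fromℕ n)) (+-monoˡ-< (fromℕ n) 0<1))

  -- Multiplication by `2 ^ n`, in the recursive form that matches `totalCost`.
  double : ℕ → Carrier → Carrier
  double zero    x = x
  double (suc n) x = double n x + double n x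

  double-cong : ∀ n {x y} → x ≈ y → double n x ≈ double n y
  double-cong zero    x≈y = x≈y
  double-cong (suc n) x≈y = +-cong (double-cong n x≈y) (double-cong n x≈y)

  double-+ : ∀ n x y → double n (x + y) ≈ double n x + double n y
  double-+ zero    x y = refl
  double-+ (suc n) x y = trans (+-cong (double-+ n x y) (double-+ n x y)) (interchange _ _ _ _)

  double-0 : ∀ n → double n 0# ≈ 0#
  double-0 zero    = refl
  double-0 (suc n) = trans (+-cong (double-0 n) (double-0 n)) (+-identityˡ 0#)

  double-mono-≤ : ∀ n {x y} → x ≤ y → double n x ≤ double n y
  double-mono-≤ zero    x≤y = x≤y
  double-mono-≤ (suc n) x≤y = +-mono-≤ (double-mono-≤ n x≤y) (double-mono-≤ n x≤y)

  double-mono-< : ∀ n {x y} → x < y → double n x < double n y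
  double-mono-< zero    x<y = x<y
  double-mono-< (suc n) {x} {y} x<y = <-trans (+-monoˡ-< (double n x) 2x<2y)
    (<-respˡ-≈ (+-comm _ _) (+-monoˡ-< (double n y) 2x<2y))
    where
    2x<2y : double n x < double n y
    2x<2y = double-mono-< n x<y

  double-cancel-≤ : ∀ n {x y} → double n x ≤ double n y → x ≤ y
  double-cancel-≤ n 2x≤2y y<x = 2x≤2y (double-mono-< n y<x)

-- Averaging over random bits against a randomized algorithm.

module Online {c ℓ₁ ℓ₂} (ℝ : RealNumbers c ℓ₁ ℓ₂) (X : FiniteMetricSpace ℝ) {m : ℕ}
              (K : Fin m → Subset (FiniteMetricSpace.size X)) where
  open RealNumbers ℝ hiding (zero)
  open CommutativeRing commutativeRing using (semiring; +-commutativeSemigroup)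
  open import Algebra.Properties.CommutativeSemigroup +-commutativeSemigroup using (interchange)
  open import Algebra.Properties.Semiring.Sum semiring using (sum-cong-≋; ∑-distrib-+; *-distribʳ-sum)
  open Reals ℝ
  open FiniteMetricSpace X using (size; d; Point; isMetric)
  open MSS ℝ X K

  cost≥0 : ∀ s {ρ} (xs : Solution ρ) → 0# ≤ cost s xs
  cost≥0 s []             = ≤-refl
  cost≥0 s ((x , _) ∷ xs) = +-nonneg (IsGeneralMetric.nonNegative isMetric) (cost≥0 x xs)

  expectation-lower : ∀ {S} (D : Distribution S) {f v} → (∀ x → x ∈ S → v ≤ f x) →
                      v ≤ Distribution.expectation D f
  expectation-lower {S} D {f} {v} v≤f = begin
    v                         ≈⟨ *-identityˡ v ⟨
    1# * v                    ≈⟨ *-congʳ total ⟨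
    sum mass * v              ≈⟨ *-distribʳ-sum v mass ⟩
    sum (λ x → mass x * v)    ≤⟨ sum-mono pointwise ⟩
    sum (λ x → mass x * f x)  ∎
    where
    open Distribution D
    pointwise : ∀ x → mass x * v ≤ mass x * f x
    pointwise x with x ∈? S
    ... | yes x∈S = *-monoˡ-≤-nonneg (mass≥0 x) (v≤f x x∈S)
    ... | no  x∉S = ≤-reflexive (trans (vanish v) (sym (vanish (f x))))
      where
      vanish : ∀ y → mass x * y ≈ 0#
      vanish y = trans (*-congʳ (supported x x∉S)) (zeroˡ y)

  expectation-+ : ∀ {S} (D : Distribution S) f g →
    Distribution.expectation D (λ x → f x + g x) ≈
    Distribution.expectation D f + Distribution.expectation D g
  expectation-+ D f g = trans (sum-cong-≋ (λ x → distribˡ (mass x) (f x) (g x)))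
    (∑-distrib-+ (λ x → mass x * f x) (λ x → mass x * g x))
    where open Distribution D

  expectation-cong : ∀ {S} (D : Distribution S) {f g} → (∀ x → f x ≈ g x) →
    Distribution.expectation D f ≈ Distribution.expectation D g
  expectation-cong D f≈g = sum-cong-≋ (λ x → *-congˡ (f≈g x))

  module _ (A : RandomizedAlgorithm) (s₀ : Point) where

    -- The expected cost against uniformly random bits, scaled by
    -- 2 ^ length ps to avoid division.
    totalCost : List (Fin 2 → List Request) → List Request → History → Point → Carrier
    totalCost []       w h s = expectedCostFrom A s₀ h s w
    totalCost (p ∷ ps) w h s = totalCost ps (w ++ p zero) h s + totalCost ps (w ++ p (suc zero)) h s

    -- The online property enters here: `r` precedes all undecided bits, so the algorithm answers it
    -- with the same distribution in every branch.
    totalCost-∷ : ∀ ps r w h s → totalCost ps (r ∷ w) h s ≈ Distribution.expectation (A s₀ h r)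
      (λ x → double (length ps) (d s x) + totalCost ps w ((r , x) ∷ h) x)
    totalCost-∷ []       r w h s = refl
    totalCost-∷ (p ∷ ps) r w h s = trans
      (+-cong (totalCost-∷ ps r (w ++ p zero) h s) (totalCost-∷ ps r (w ++ p (suc zero)) h s))
      (trans (sym (expectation-+ (A s₀ h r) _ _))
        (expectation-cong (A s₀ h r) (λ x → interchange _ _ _ _)))

    -- Whatever states are drawn, serving `w` costs at least `u`, and `v` covers the rest from any
    -- history and state. Induction on `w` lowers `u` by the distance moved, possibly below zero.
    totalCost-lower : ∀ ps {v} → (∀ h s → v ≤ totalCost ps [] h s) →
      ∀ w {u h s} → (∀ (xs : Solution w) → u ≤ cost s xs) →
      double (length ps) u + v ≤ totalCost ps w h s
    totalCost-lower ps {v} low [] {u} {h} {s} u≤ = begin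
      double (length ps) u + v   ≤⟨ +-monoˡ-≤ v (double-mono-≤ (length ps) (u≤ [])) ⟩
      double (length ps) 0# + v  ≈⟨ +-congʳ (double-0 (length ps)) ⟩
      0# + v                     ≈⟨ +-identityˡ v ⟩
      v                          ≤⟨ low h s ⟩
      totalCost ps [] h s        ∎
    totalCost-lower ps {v} low (r ∷ w) {u} {h} {s} u≤ =
      ≤-trans (expectation-lower (A s₀ h r) move) (≤-reflexive (sym (totalCost-∷ ps r w h s)))
      where
      n : ℕ
      n = length ps
      move : ∀ x → x ∈ K r → double n u + v ≤ double n (d s x) + totalCost ps w ((r , x) ∷ h) x
      move x x∈ = begin
        double n u + v
          ≈⟨ +-congʳ (double-cong n (trans (sym (x-y+y≈x u (d s x))) (+-comm _ _))) ⟩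
        double n (d s x + (u - d s x)) + v
          ≈⟨ +-congʳ (double-+ n (d s x) (u - d s x)) ⟩
        double n (d s x) + double n (u - d s x) + v
          ≈⟨ +-assoc _ _ v ⟩
        double n (d s x) + (double n (u - d s x) + v)
          ≤⟨ +-monoʳ-≤ _ (totalCost-lower ps low w rest) ⟩
        double n (d s x) + totalCost ps w ((r , x) ∷ h) x ∎
        where
        rest : ∀ (xs : Solution w) → u - d s x ≤ cost x xs
        rest xs = +-cancelˡ-≤ (d s x) (≤-trans
          (≤-reflexive (trans (+-comm _ _) (x-y+y≈x u (d s x)))) (u≤ ((x , x∈) ∷ xs)))

    -- One value of the bit, depending on the current state, costs at least `H + H` and the other at
    -- least `0`, which averages to `H` per bit.
    totalCost-bits : ∀ {H} ps →
      All (λ p → ∀ s → ∃[ β ] ∀ (xs : Solution (p β)) → H + H ≤ cost s xs) ps →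
      ∀ h s → double (length ps) (length ps · H) ≤ totalCost ps [] h s
    totalCost-bits []       []            h s = ≤-refl
    totalCost-bits {H} (p ∷ ps) (hard ∷ hards) h s = begin
      double n (H + n · H) + double n (H + n · H)  ≈⟨ +-cong (double-+ n H (n · H)) (double-+ n H (n · H)) ⟩
      (η + v) + (η + v)                            ≈⟨ interchange η v η v ⟩
      (η + η) + (v + v)                            ≈⟨ +-assoc (η + η) v v ⟨
      η + η + v + v                                ≤⟨ either (hard s) ⟩
      totalCost ps (p zero) h s + totalCost ps (p (suc zero)) h s ∎
      where
      n : ℕ
      n = length ps
      η v : Carrier
      η = double n H
      v = double n (n · H)
      any-bit : ∀ β → v ≤ totalCost ps (p β) h s
      any-bit β = begin
        v                 ≈⟨ +-identityˡ v ⟨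
        0# + v            ≈⟨ +-congʳ (double-0 n) ⟨
        double n 0# + v   ≤⟨ totalCost-lower ps (totalCost-bits ps hards) (p β) (cost≥0 s) ⟩
        totalCost ps (p β) h s ∎
      bad-bit : ∀ β → (∀ (xs : Solution (p β)) → H + H ≤ cost s xs) →
                η + η + v ≤ totalCost ps (p β) h s
      bad-bit β bad = ≤-trans (≤-reflexive (+-congʳ (sym (double-+ n H H))))
        (totalCost-lower ps (totalCost-bits ps hards) (p β) bad)
      either : (∃[ β ] ∀ (xs : Solution (p β)) → H + H ≤ cost s xs) →
               η + η + v + v ≤ totalCost ps (p zero) h s + totalCost ps (p (suc zero)) h s
      either (zero     , bad) = +-mono-≤ (bad-bit zero bad) (any-bit (suc zero))
      either (suc zero , bad) = ≤-trans (≤-reflexive (+-comm _ v))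
                                  (+-mono-≤ (any-bit zero) (bad-bit (suc zero) bad))

    totalCost-upper : ∀ {U} ps w h s →
      (∀ {ρ} → Outcome ps ρ → expectedCostFrom A s₀ h s (w ++ ρ) ≤ U) →
      totalCost ps w h s ≤ double (length ps) U
    totalCost-upper {U} []       w h s up =
      subst (λ w → expectedCostFrom A s₀ h s w ≤ U) (++-identityʳ w) (up [])
    totalCost-upper {U} (p ∷ ps) w h s up = +-mono-≤ (bit zero) (bit (suc zero))
      where
      bit : ∀ β → totalCost ps (w ++ p β) h s ≤ double (length ps) U
      bit β = totalCost-upper ps (w ++ p β) h s λ {ρ} o →
        subst (λ w → expectedCostFrom A s₀ h s w ≤ U) (≡.sym (++-assoc w (p β) ρ)) (up (pick β o))

    -- Yao's principle: the average over all outcomes lies below any bound common to them. The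
    -- factor `2 ^ length ps` cancels.
    random-bits-bound : ∀ {H U} ps →
      All (λ p → ∀ s → ∃[ β ] ∀ (xs : Solution (p β)) → H + H ≤ cost s xs) ps →
      (∀ {ρ} → Outcome ps ρ → expectedCost A s₀ ρ ≤ U) → length ps · H ≤ U
    random-bits-bound ps hards up = double-cancel-≤ (length ps)
      (≤-trans (totalCost-bits ps hards [] s₀) (totalCost-upper ps [] [] s₀ up))

-- Edge weights realizing the integer distances.

module Metric {c ℓ₁ ℓ₂} (ℝ : RealNumbers c ℓ₁ ℓ₂) (b : ℕ) where
  open RealNumbers ℝ hiding (zero)
  open Reals ℝ

  private
    B : ℕ
    B = 2 ℕ.+ b

  -- Chosen so that a node of level suc l has depth B ^ l.
  weightℕ : ℕ → ℕ
  weightℕ zero          = 1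
  weightℕ (suc zero)    = 1
  weightℕ (suc (suc l)) = suc b ℕ.* B ^ l

  weight : ℕ → Carrier
  weight l = fromℕ (weightℕ l)

  weight>0 : ∀ l → 0# < weight l
  weight>0 zero          = fromℕ>0 ℕₚ.≤-refl
  weight>0 (suc zero)    = fromℕ>0 ℕₚ.≤-refl
  weight>0 (suc (suc l)) = fromℕ>0 (ℕₚ.≤-trans (ℕₚ.m^n>0 B l) (ℕₚ.m≤m+n (B ^ l) (b ℕ.* B ^ l)))

  depth≈ : ∀ l → depth ℝ weight (suc l) ≈ fromℕ (B ^ l)
  depth≈ zero    = +-identityʳ (fromℕ 1)
  depth≈ (suc l) = trans (+-congˡ (depth≈ l)) (trans (+-comm _ _)
    (sym (fromℕ-homo-+ (B ^ l) (suc b ℕ.* B ^ l))))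

  fromℕ-gap : ∀ l → fromℕ (gap B l) ≈ fromℕ (B ^ l) + fromℕ (B ^ l)
  fromℕ-gap l = trans (fromℕ-homo-+ (B ^ l) (B ^ l ℕ.+ 0))
    (+-congˡ (trans (fromℕ-homo-+ (B ^ l) 0) (+-identityʳ _)))

  pathDistance≈ : ∀ {l} {t : Tree l} (x y : Leaf t) →
                  pathDistance ℝ weight x y ≈ fromℕ (leafDistance B x y)
  pathDistance≈ root root = refl
  pathDistance≈ {suc l} (below i x) (below j y) with i ≟ j
  ... | yes ≡.refl = pathDistance≈ x y
  ... | no _       = trans (+-cong (depth≈ l) (depth≈ l)) (sym (fromℕ-gap l))

-- Comparison of online and offline cost.

module LowerBound {c ℓ₁ ℓ₂} (ℝ : RealNumbers c ℓ₁ ℓ₂) (q k : ℕ) where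
  open RealNumbers ℝ hiding (zero)
  open Reals ℝ
  open Hard q k
  open Metric ℝ (k ℕ.* wordCostFactor L)

  hst : HST ℝ
  hst = record { tree = tree ; weight = weight ; weight>0 = weight>0 }

  open MSS ℝ (leafSpace ℝ hst) K

  at : Point → Leaf tree
  at = Inverse.to (enumerateLeaves tree)

  -- Carried back to the integers from the real tree distance.
  triangle : ∀ x y z → dist x z ℕ.≤ dist x y ℕ.+ dist y z
  triangle x y z = fromℕ-cancel (begin
    fromℕ (dist x z)                     ≈⟨ pathDistance≈ (at x) (at z) ⟨
    D x z                                ≤⟨ pathDistance-triangle ℝ weight>0 (at x) (at y) (at z) ⟩
    D x y + D y z                        ≈⟨ +-cong (pathDistance≈ (at x) (at y)) (pathDistance≈ (at y) (at z)) ⟩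
    fromℕ (dist x y) + fromℕ (dist y z)  ≈⟨ fromℕ-homo-+ (dist x y) (dist y z) ⟨
    fromℕ (dist x y ℕ.+ dist y z)        ∎)
    where
    D : Point → Point → Carrier
    D x y = pathDistance ℝ weight (at x) (at y)

  cost≈ : ∀ s {ρ} (xs : Solution ρ) → cost s xs ≈ fromℕ (travel s xs)
  cost≈ s []             = refl
  cost≈ s ((x , _) ∷ xs) = trans (+-cong (pathDistance≈ (at s) (at x)) (cost≈ x xs))
    (sym (fromℕ-homo-+ (dist s x) (travel x xs)))

  bits-hard : ∀ n → All (λ p → ∀ s → ∃[ β ] ∀ (xs : Solution (p β)) →
    fromℕ (B ^ L) + fromℕ (B ^ L) ≤ cost s xs) (phases n)
  bits-hard n = concat⁺ (replicate⁺ n (tabulate⁺ hard))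
    where
    hard : ∀ j s → ∃[ β ] ∀ (xs : Solution (bit j β)) → fromℕ (B ^ L) + fromℕ (B ^ L) ≤ cost s xs
    hard j s with β , low ← wrong-bit-costs j s = β , λ xs → begin
      fromℕ (B ^ L) + fromℕ (B ^ L)  ≈⟨ fromℕ-gap L ⟨
      fromℕ (gap B L)                ≤⟨ fromℕ-mono (low xs) ⟩
      fromℕ (travel s xs)            ≈⟨ cost≈ s xs ⟨
      cost s xs                      ∎

  module _ (ratio : ℕ) (k≡ : k ≡ 1 ℕ.+ 4 ℕ.* ratio)
           (A : RandomizedAlgorithm) {γ β : Carrier} (γ≤ratio : γ ≤ fromℕ ratio)
           (competitive : ∀ s₀ ρ v → IsOptimalCost s₀ ρ v → expectedCost A s₀ ρ ≤ γ * v + β) where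

    expectedCost-upper : ∀ n {ρ} → Outcome (phases n) ρ → ∀ s →
                         expectedCost A s ρ ≤ fromℕ (ratio ℕ.* (n ℕ.* phaseCost)) + β
    expectedCost-upper n {ρ} o s with phases-costsAtMost triangle n o s
    -- The optimal path exists only under a double negation, which the goal, a negated strict
    -- inequality, absorbs.
    ... | path , path≤ = λ exceeds → ¬¬-optimalPath s path λ (xs , optimal) →
      bounded xs optimal exceeds
      where
      bounded : ∀ (xs : Solution ρ) → CostsAtLeast s ρ (travel s xs) →
                expectedCost A s ρ ≤ fromℕ (ratio ℕ.* (n ℕ.* phaseCost)) + β
      bounded xs optimal = begin
        expectedCost A s ρ
          ≤⟨ competitive s ρ v ((xs , cost≈ s xs) , λ ys →
               ≤-trans (fromℕ-mono (optimal ys)) (≤-reflexive (sym (cost≈ s ys)))) ⟩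
        γ * v + β
          ≤⟨ +-monoˡ-≤ β (begin
               γ * v            ≈⟨ *-comm γ v ⟩
               v * γ            ≤⟨ *-monoˡ-≤-nonneg (fromℕ≥0 (travel s xs)) γ≤ratio ⟩
               v * fromℕ ratio  ≈⟨ *-comm v (fromℕ ratio) ⟩
               fromℕ ratio * v  ≤⟨ *-monoˡ-≤-nonneg (fromℕ≥0 ratio)
                                     (fromℕ-mono (ℕₚ.≤-trans (optimal path) path≤)) ⟩
               fromℕ ratio * fromℕ (n ℕ.* phaseCost)  ≈⟨ fromℕ-homo-* ratio (n ℕ.* phaseCost) ⟨
               fromℕ (ratio ℕ.* (n ℕ.* phaseCost))    ∎) ⟩
        fromℕ (ratio ℕ.* (n ℕ.* phaseCost)) + β ∎
        where
        v : Carrier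
        v = fromℕ (travel s xs)

    -- With `x` half of `gap B L`, a phase costs the algorithm at least `k * x` on average and the
    -- offline path at most `4 * x`; for `k ≡ 1 + 4 * ratio` an excess of `x` per phase remains.
    bits-in-phases : ∀ n x →
      n ℕ.* k ℕ.* x ≡ ratio ℕ.* (n ℕ.* (2 ℕ.* x ℕ.+ 2 ℕ.* x)) ℕ.+ n ℕ.* x
    bits-in-phases n x rewrite k≡ = solve 3 (λ c n x →
      n :* (con 1 :+ con 4 :* c) :* x := c :* (n :* (con 2 :* x :+ con 2 :* x)) :+ n :* x)
      ≡.refl ratio n x
      where open +-*-Solver

    -- The additive constant must absorb the excess of any number of phases, each at least `1`
    -- because `B ^ L` is positive.
    excess≤β : ∀ n → fromℕ n ≤ β
    excess≤β n = +-cancelˡ-≤ (fromℕ total) (begin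
      fromℕ total + fromℕ n
        ≤⟨ +-monoʳ-≤ (fromℕ total) (fromℕ-mono (ℕₚ.m≤m*n n (B ^ L) {{ℕₚ.m^n≢0 B L}})) ⟩
      fromℕ total + fromℕ (n ℕ.* B ^ L)
        ≈⟨ fromℕ-homo-+ total (n ℕ.* B ^ L) ⟨
      fromℕ (total ℕ.+ n ℕ.* B ^ L)
        ≡⟨ ≡.cong fromℕ (bits-in-phases n (B ^ L)) ⟨
      fromℕ (n ℕ.* k ℕ.* B ^ L)
        ≡⟨ ≡.cong (λ b → fromℕ (b ℕ.* B ^ L)) (length-phases n) ⟨
      fromℕ (length (phases n) ℕ.* B ^ L)
        ≈⟨ ·-fromℕ (length (phases n)) (B ^ L) ⟨
      length (phases n) · fromℕ (B ^ L)
        ≤⟨ Online.random-bits-bound ℝ (leafSpace ℝ hst) K A s₀ (phases n) (bits-hard n)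
             (λ o → expectedCost-upper n o s₀) ⟩
      fromℕ total + β ∎)
      where
      total : ℕ
      total = ratio ℕ.* (n ℕ.* phaseCost)
      s₀ : Point
      s₀ = Inverse.from (enumerateLeaves tree) (firstLeaf tree)

    not-competitive : ⊥
    not-competitive with n , β<n ← archimedean β = excess≤β n β<n

corollary1p4 : ∀ {c ℓ₁ ℓ₂} (ℝ : RealNumbers c ℓ₁ ℓ₂) (m : ℕ) → 4 ℕ.≤ m →
    ∀ (C : RealNumbers.Carrier ℝ) →
    Σ[ T ∈ HST ℝ ]
    Σ[ K ∈ (Fin m → Subset (FiniteMetricSpace.size (leafSpace ℝ T))) ]
    (∀ i → Nonempty (K i)) ×
    ¬ (Σ[ A ∈ MSS.RandomizedAlgorithm ℝ (leafSpace ℝ T) K ]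
    Σ[ γ ∈ RealNumbers.Carrier ℝ ]
    RealNumbers._≤_ ℝ γ C ×
    MSS.HasCompetitiveRatio ℝ (leafSpace ℝ T) K A γ)
corollary1p4 ℝ (suc (suc (suc (suc q)))) (s≤s (s≤s (s≤s (s≤s z≤n)))) C
  with ratio , C<ratio ← RealNumbers.archimedean ℝ C =
  -- Here `q` counts the request types beyond four, and the number of bits exceeds `4 * ratio`
  -- because a phase costs up to four half gaps offline.
  LowerBound.hst ℝ q (1 ℕ.+ 4 ℕ.* ratio) ,
  Hard.K q (1 ℕ.+ 4 ℕ.* ratio) ,
  Hard.K-nonempty q (1 ℕ.+ 4 ℕ.* ratio) ,
  λ (A , γ , γ≤C , β , competitive) → LowerBound.not-competitive ℝ q (1 ℕ.+ 4 ℕ.* ratio) ratio ≡.refl A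
    (RealNumbers.≤-trans ℝ γ≤C (RealNumbers.<⇒≤ ℝ C<ratio)) competitive
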